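{- For any positive integers $\mu$ and $t$, there is an integer $K(\mu,t)$ such that every $K_{t,t}$-free graph $G$ with $\mathrm{tree}\text{ - }\mu(G)\leq\mu$ satisfies $\mathrm{tree}\text{ - }\alpha(G)<K(\mu,t)$.
   Context: All graphs are finite, simple, undirected, and have at least one vertex. $K_{t,t}$ is the complete bipartite graph with $t$ vertices on each side; a graph $G$ is $K_{t,t}$-free if no induced subgraph of $G$ is isomorphic to $K_{t,t}$. For $X\subseteq V(G)$, $\alpha(X)$ denotes the maximum size of an independent set of $G$ contained in $X$. A tree decomposition of a graph $G$ is a pair $\mathcal{T}=(T,\beta)$ where $T$ is a tree and $\beta$ maps each node $x$ of $T$ to a set $\beta(x)\subseteq V(G)$ (a bag) such that: (1) every vertex of $G$ belongs to some bag; (2) for every edge $uv$ of $G$, some bag contains both $u$ and $v$; (3) for every vertex $v$ of $G$, the set $\{x\in V(T)\mid v\in\beta(x)\}$ induces a connected subgraph of $T$. An induced matching in $G$ is a set $M$ of pairwise disjoint edges of $G$ such that no vertex of one edge of $M$ is adjacent in $G$ to a vertex of a different edge of $M$. An induced matching $M$ touches a set $X\subseteq V(G)$ if every edge of $M$ has at least one endpoint in $X$. For a tree decomposition $\mathcal{T}=(T,\beta)$ of $G$: $\alpha(\mathcal{T})=\max_{x\in V(T)}\alpha(\beta(x))$, and $\mu(\mathcal{T})$ is the maximum, over $x\in V(T)$, of the maximum size of an induced matching in $G$ that touches $\beta(x)$. The tree-independence number $\mathrm{tree}\text{ - }\alpha(G)$ is the minimum of $\alpha(\mathcal{T})$, and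 the induced matching treewidth $\mathrm{tree}\text{ - }\mu(G)$ is the minimum of $\mu(\mathcal{T})$, over all tree decompositions $\mathcal{T}$ of $G$. -}

module Defs where

open import Level using (Level; 0ℓ)
open import Data.Bool using (Bool; true; false)
import Data.Bool as Bool
import Data.Fin as Fin
open import Data.Empty using () renaming (⊥ to Empty)
open import Data.Fin using (Fin; zero; suc; inject₁; fromℕ; splitAt)
open import Data.Fin.Properties using (injective⇒≤)
open import Data.Fin.Subset using (Subset; _∈_; _⊆_; ∣_∣; ⊤; ⊥)
open import Data.Fin.Subset.Properties using (∣p∣≤n; ∣⊥∣≡0; ∉⊥; ⊥⊆; ∈⊤)
open import Data.Nat using (ℕ; zero; suc; _+_; _∸_; _≤_; NonZero)
open import Data.Nat.Induction using (<-rec)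
open import Data.Nat.Properties using (≮⇒≥; ∸-monoʳ-<; ≤-antisym)
open import Data.Product using (∃; _×_; _,_)
open import Data.Sum using (_⊎_; inj₁; [_,_]′)
open import Function using (_∘_; const)
open import Function.Bundles using (_⇔_)
open import Function.Definitions using (Injective)
open import Relation.Binary using (Rel; Symmetric; Irreflexive; Decidable)
open import Relation.Binary.Construct.Closure.ReflexiveTransitive using (Star; ε)
open import Relation.Binary.PropositionalEquality
  using (_≡_; _≢_; refl; ≢-sym)
open import Relation.Nullary using (¬_; no; contradiction)
open import Relation.Nullary.Decidable using (¬?; decidable-stable)

private
  variable
    ℓ : Level

-- Maxima and minima of sets of naturals are given by their graphs: a
-- minimum over all tree decompositions ranges over an infinite collection.

IsMaximum : (ℕ → Set ℓ) → ℕ → Set ℓ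
IsMaximum P m = P m × (∀ {k} → P k → k ≤ m)

IsMinimum : (ℕ → Set ℓ) → ℕ → Set ℓ
IsMinimum P m = P m × (∀ {k} → P k → m ≤ k)

record Graph : Set₁ where
  field
    order    : ℕ
    nonempty : NonZero order
  V : Set
  V = Fin order
  field
    Adj        : Rel V 0ℓ
    adj?       : Decidable Adj
    adj-sym    : Symmetric Adj
    adj-irrefl : Irreflexive _≡_ Adj

open Graph using (order; V; Adj)

-- The two sides are the first t and the last t elements of Fin (t + t).
side : ∀ t → Fin (t + t) → Bool
side t u = [ const true , const false ]′ (splitAt t u)

t+t≢0 : ∀ t → .{{NonZero t}} → NonZero (t + t)
t+t≢0 (suc t) = _

Biclique : ∀ t → .{{NonZero t}} → Graph
Biclique t = record
  { order      = t + t
  ; nonempty   = t+t≢0 t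
  ; Adj        = λ u v → side t u ≢ side t v
  ; adj?       = λ u v → ¬? (side t u Bool.≟ side t v)
  ; adj-sym    = ≢-sym
  ; adj-irrefl = λ { refl s≢s → s≢s refl }
  }

-- An isomorphism of H with an induced subgraph of G, namely the one induced
-- by the image of the embedding.
record InducedCopy (H G : Graph) : Set where
  field
    embed     : V H → V G
    injective : Injective _≡_ _≡_ embed
    adjacency : ∀ u v → Adj H u v ⇔ Adj G (embed u) (embed v)

Biclique-free : ∀ t → .{{NonZero t}} → Graph → Set
Biclique-free t G = ¬ InducedCopy (Biclique t) G

-- G[ P ] is connected.
InducesConnected : (G : Graph) → (V G → Set) → Set
InducesConnected G P =
  ∀ {u v} → P u → P v → Star (λ x y → P x × P y × Adj G x y) u v

Connected : Graph → Set
Connected G = ∀ u v → Star (Adj G) u v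

-- A cycle v₀ v₁ … vₖ₊₂ of length k + 3, without repeated vertices.
record Cycle (G : Graph) : Set where
  field
    {k}      : ℕ
    vertex   : Fin (3 + k) → V G
    distinct : Injective _≡_ _≡_ vertex
    step     : ∀ (i : Fin (2 + k)) → Adj G (vertex (inject₁ i)) (vertex (suc i))
    close    : Adj G (vertex (fromℕ (2 + k))) (vertex zero)

IsTree : Graph → Set
IsTree T = Connected T × ¬ Cycle T

record TreeDecomposition (G : Graph) : Set₁ where
  field
    T              : Graph
    isTree         : IsTree T
    β              : V T → Subset (order G)
    vertex-covered : ∀ v → ∃ λ x → v ∈ β x
    edge-covered   : ∀ {u v} → Adj G u v → ∃ λ x → u ∈ β x × v ∈ β x
    connected      : ∀ v → InducesConnected T (λ x → v ∈ β x)

module _ (G : Graph) where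

  Independent : Subset (order G) → Set
  Independent S = ∀ u v → u ∈ S → v ∈ S → ¬ Adj G u v

  -- α(X) ≡ a
  IsIndependenceNumber : Subset (order G) → ℕ → Set
  IsIndependenceNumber X =
    IsMaximum λ k → ∃ λ S → Independent S × S ⊆ X × ∣ S ∣ ≡ k

  record Edge : Set where
    field
      src tgt  : V G
      adjacent : Adj G src tgt

  _∈ₑ_ : V G → Edge → Set
  v ∈ₑ e = v ≡ Edge.src e ⊎ v ≡ Edge.tgt e

  -- An enumerated induced matching of size k; disjointness makes the k edges
  -- distinct, also as unordered pairs.
  record InducedMatching (k : ℕ) : Set where
    field
      edge     : Fin k → Edge
      disjoint : ∀ {i j u v} → i ≢ j → u ∈ₑ edge i → v ∈ₑ edge j → u ≢ v
      induced  : ∀ {i j u v} → i ≢ j → u ∈ₑ edge i → v ∈ₑ edge j → ¬ Adj G u v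

  Touches : ∀ {k} → InducedMatching k → Subset (order G) → Set
  Touches M X = ∀ i → ∃ λ v → v ∈ₑ InducedMatching.edge M i × v ∈ X

  IsTouchingNumber : Subset (order G) → ℕ → Set
  IsTouchingNumber X =
    IsMaximum λ k → ∃ λ (M : InducedMatching k) → Touches M X

  module _ (𝒯 : TreeDecomposition G) where
    open TreeDecomposition 𝒯

    -- α(𝒯) ≡ a
    IsDecomposition-α : ℕ → Set
    IsDecomposition-α = IsMaximum λ k → ∃ λ x → IsIndependenceNumber (β x) k

    -- μ(𝒯) ≡ m
    IsDecomposition-μ : ℕ → Set
    IsDecomposition-μ = IsMaximum λ k → ∃ λ x → IsTouchingNumber (β x) k

  -- tree-α(G) ≡ a
  IsTree-α : ℕ → Set₁
  IsTree-α = IsMinimum λ k → ∃ λ 𝒯 → IsDecomposition-α 𝒯 k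

  -- tree-μ(G) ≡ m
  IsTree-μ : ℕ → Set₁
  IsTree-μ = IsMinimum λ k → ∃ λ 𝒯 → IsDecomposition-μ 𝒯 k

-- The values tree-α(G) and tree-μ(G) exist (up to double negation, which is
-- harmless for the decidable inequalities they enter) and are unique.

¬¬-minimum : {P : ℕ → Set ℓ} → ¬ ¬ ∃ P → ¬ ¬ ∃ (IsMinimum P)
¬¬-minimum {P = P} ¬¬p none = ¬¬p λ (k , p) → <-rec (λ k → ¬ P k)
  (λ k below p → none (k , p , λ p′ → ≮⇒≥ λ k′<k → below k′<k p′)) k p

¬¬-maximum : {P : ℕ → Set ℓ} (b : ℕ) → (∀ {k} → P k → k ≤ b) →
             ¬ ¬ ∃ P → ¬ ¬ ∃ (IsMaximum P)
¬¬-maximum {P = P} b bound ¬¬p none = ¬¬p λ (k , p) →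
  <-rec (λ d → ∀ k → d ≡ b ∸ k → ¬ P k)
    (λ { _ above k refl p → none (k , p , λ p′ →
         ≮⇒≥ λ k<k′ → above (∸-monoʳ-< k<k′ (bound p′)) _ refl p′) })
    (b ∸ k) k refl p

point : Graph
point = record
  { order = 1 ; nonempty = _ ; Adj = λ _ _ → Empty ; adj? = λ _ _ → no λ ()
  ; adj-sym = λ () ; adj-irrefl = λ _ () }

oneBag : ∀ G → TreeDecomposition G
oneBag G = record
  { T              = point
  ; isTree         = (λ { zero zero → ε }) , Cycle.close
  ; β              = λ _ → ⊤
  ; vertex-covered = λ _ → zero , ∈⊤
  ; edge-covered   = λ _ → zero , ∈⊤ , ∈⊤
  ; connected      = λ { _ {zero} {zero} _ _ → ε }
  }

matching≤order : ∀ G {k} → InducedMatching G k → k ≤ order G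
matching≤order G M = injective⇒≤ {f = Edge.src ∘ edge} λ {i} {j} eq →
  decidable-stable (i Fin.≟ j) λ i≢j → disjoint i≢j (inj₁ refl) (inj₁ refl) eq
  where open InducedMatching M

α-exists : ∀ G X → ¬ ¬ ∃ (IsIndependenceNumber G X)
α-exists G X = ¬¬-maximum (order G)
  (λ { (S , _ , _ , refl) → ∣p∣≤n S })
  λ none → none
    (0 , ⊥ , (λ _ _ u∈⊥ → contradiction u∈⊥ ∉⊥) , (λ {_} → ⊥⊆) , ∣⊥∣≡0 (order G))

μ-exists : ∀ G X → ¬ ¬ ∃ (IsTouchingNumber G X)
μ-exists G X = ¬¬-maximum (order G)
  (λ { (M , _) → matching≤order G M })
  λ none → none
    (0 , record { edge = λ () ; disjoint = λ { {()} } ; induced = λ { {()} } } , λ ())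

tree-α-exists : ∀ G → ¬ ¬ ∃ (IsTree-α G)
tree-α-exists G = ¬¬-minimum λ none →
  ¬¬-maximum (order G)
    (λ { (_ , (S , _ , _ , refl) , _) → ∣p∣≤n S })
    (λ none′ → α-exists G ⊤ λ (k , p) → none′ (k , zero , p))
    λ (k , p) → none (k , oneBag G , p)

tree-μ-exists : ∀ G → ¬ ¬ ∃ (IsTree-μ G)
tree-μ-exists G = ¬¬-minimum λ none →
  ¬¬-maximum (order G)
    (λ { (_ , (M , _) , _) → matching≤order G M })
    (λ none′ → μ-exists G ⊤ λ (k , p) → none′ (k , zero , p))
    λ (k , p) → none (k , oneBag G , p)

minimum-unique : {P : ℕ → Set ℓ} {m n : ℕ} → IsMinimum P m → IsMinimum P n → m ≡ n
minimum-unique (p , p-min) (q , q-min) = ≤-antisym (p-min q) (q-min p)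

{-# OPTIONS --safe #-}

-- Call a vertex low if every independent subset of its neighbourhood has at
-- most D elements, and let I be a maximal independent set of low vertices.
-- Replace each bag X by (X ∖ I) ∪ N(I ∩ X), and for each v ∈ I attach a leaf
-- with bag N[v] to some node whose bag contains v. Two facts bound α of the
-- new bags.
--
-- Domination: let A and J be independent sets such that A dominates J, each
-- a ∈ A has at most D neighbours in J, and A or J lies in the bag X. In a
-- minimal dominating subset of A every vertex has a private neighbour in J,
-- which yields an induced matching touching X; hence |J| ≤ μ D. This bounds
-- the low part of X ∖ I (dominated by I) and N(I ∩ X) (dominated by I ∩ X).
--
-- If D is large, then X contains at most μ t independent vertices that are
-- not low. Otherwise choose μ t + 1 of them, forming B. Since G has no
-- K_{t,t}, one can pick a neighbour of each vertex of B so that the picked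
-- vertices are independent and have at most t neighbours in B each, and
-- then B contradicts domination.
module Submission where

open import Defs
open import Data.Nat using (ℕ; NonZero; _≤_; _<_)
open import Data.Product using (∃)

open import Data.Bool using (true; false)
open import Data.Empty using () renaming (⊥ to Empty)
open import Data.Fin using (Fin; zero; suc; inject₁; fromℕ; fromℕ<; splitAt; join; toℕ; _≟_)
open import Data.Fin.Properties
  using (any?; all?; ¬∀⟶∃¬; splitAt-join; join-splitAt; suc-injective; toℕ-inject₁)
open import Data.Fin.Relation.Unary.Top using (view; ‵fromℕ; ‵inject₁)
open import Data.Fin.Subset hiding (Empty)
open import Data.Fin.Subset.Properties
open import Data.Nat using (zero; suc; _+_; _*_; _^_; z≤n; s≤s; _≤?_; _<?_; ≢-nonZero; ≢-nonZero⁻¹; >-nonZero⁻¹)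
open import Data.Nat.Properties hiding (_≟_; suc-injective)
open import Data.Product using (_×_; _,_; proj₁; proj₂; ∃₂)
open import Data.Sum using (_⊎_; inj₁; inj₂; [_,_]′)
open import Data.Unit using (tt) renaming (⊤ to Unit)
open import Data.Vec using ([]; _∷_; tabulate; here; there)
open import Data.Vec.Properties using ([]=⇒lookup; lookup⇒[]=; lookup∘tabulate)
open import Function using (_∘_; id)
open import Function.Bundles using (_⇔_; mk⇔)
open import Function.Definitions using (Injective)
open import Relation.Binary.Construct.Closure.ReflexiveTransitive using (Star; ε; _◅_; _◅◅_)
import Relation.Binary.Construct.Closure.ReflexiveTransitive as Star
open import Relation.Binary.PropositionalEquality
open import Relation.Nullary using (¬_; Dec; yes; no; does; contradiction)
open import Relation.Nullary.Decidable
  using (¬?; _×-dec_; _⊎-dec_; _→-dec_; decidable-stable; dec-true)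
open import Relation.Unary using (Decidable)

open Graph using (order; V; Adj)

private
  variable
    n : ℕ

-- Finite subsets

select : {P : Fin n → Set} → Decidable P → Subset n
select P? = tabulate (does ∘ P?)

module _ {P : Fin n → Set} (P? : Decidable P) where

  ∈-select⁺ : ∀ {x} → P x → x ∈ select P?
  ∈-select⁺ {x} px =
    lookup⇒[]= x _ (trans (lookup∘tabulate _ x) (dec-true (P? x) px))

  ∈-select⁻ : ∀ {x} → x ∈ select P? → P x
  ∈-select⁻ {x} x∈ with P? x | trans (sym (lookup∘tabulate (does ∘ P?) x)) ([]=⇒lookup x∈)
  ... | yes px | _ = px
  ... | no _   | ()

x∈p─q⇒x∉q : ∀ {p q : Subset n} {x} → x ∈ p ─ q → x ∉ q
x∈p─q⇒x∉q {p = _ ∷ _} {true ∷ _}  {zero}  ()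
x∈p─q⇒x∉q {p = _ ∷ _} {false ∷ _} {zero}  _ ()
x∈p─q⇒x∉q {p = _ ∷ p} {true ∷ q}  {suc x} (there x∈) (there x∈q) = x∈p─q⇒x∉q {p = p} {q} x∈ x∈q
x∈p─q⇒x∉q {p = _ ∷ p} {false ∷ q} {suc x} (there x∈) (there x∈q) = x∈p─q⇒x∉q {p = p} {q} x∈ x∈q

∣p∪q∣≤∣p∣+∣q∣ : ∀ (p q : Subset n) → ∣ p ∪ q ∣ ≤ ∣ p ∣ + ∣ q ∣
∣p∪q∣≤∣p∣+∣q∣ []          []          = z≤n
∣p∪q∣≤∣p∣+∣q∣ (true ∷ p)  (true ∷ q)  =
  s≤s (≤-trans (∣p∪q∣≤∣p∣+∣q∣ p q) (+-monoʳ-≤ ∣ p ∣ (n≤1+n _)))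
∣p∪q∣≤∣p∣+∣q∣ (true ∷ p)  (false ∷ q) = s≤s (∣p∪q∣≤∣p∣+∣q∣ p q)
∣p∪q∣≤∣p∣+∣q∣ (false ∷ p) (true ∷ q)  =
  ≤-trans (s≤s (∣p∪q∣≤∣p∣+∣q∣ p q)) (≤-reflexive (sym (+-suc ∣ p ∣ ∣ q ∣)))
∣p∪q∣≤∣p∣+∣q∣ (false ∷ p) (false ∷ q) = ∣p∪q∣≤∣p∣+∣q∣ p q

cover-bound : ∀ {p : Subset n} q r → (∀ {x} → x ∈ p → x ∈ q ⊎ x ∈ r) → ∣ p ∣ ≤ ∣ q ∣ + ∣ r ∣
cover-bound q r cover =
  ≤-trans (p⊆q⇒∣p∣≤∣q∣ (x∈p∪q⁺ ∘ cover)) (∣p∪q∣≤∣p∣+∣q∣ q r)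

∩-or-─ : ∀ {p : Subset n} q {x} → x ∈ p → x ∈ p ∩ q ⊎ x ∈ p ─ q
∩-or-─ {p = p} q {x} x∈p with x ∈? q
... | yes x∈q = inj₁ (x∈p∩q⁺ (x∈p , x∈q))
... | no  x∉q = inj₂ (x∈p∧x∉q⇒x∈p─q x∈p x∉q)

∣p∣≤∣p∩q∣+∣p─q∣ : ∀ (p q : Subset n) → ∣ p ∣ ≤ ∣ p ∩ q ∣ + ∣ p ─ q ∣
∣p∣≤∣p∩q∣+∣p─q∣ p q = cover-bound (p ∩ q) (p ─ q) (∩-or-─ q)

union-bound : ∀ {p : Subset n} {D} k (F : Fin k → Subset n) →
              (∀ {x} → x ∈ p → ∃ λ i → x ∈ F i) → (∀ i → ∣ F i ∣ ≤ D) → ∣ p ∣ ≤ k * D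
union-bound {n = n} zero F cover F≤D =
  ≤-trans (p⊆q⇒∣p∣≤∣q∣ {q = ⊥} λ x∈p → contradiction (proj₁ (cover x∈p)) λ ())
          (≤-reflexive (∣⊥∣≡0 n))
union-bound {p = p} (suc k) F cover F≤D = begin
  ∣ p ∣                           ≤⟨ ∣p∣≤∣p∩q∣+∣p─q∣ p (F zero) ⟩
  ∣ p ∩ F zero ∣ + ∣ p ─ F zero ∣ ≤⟨ +-mono-≤ (≤-trans (∣p∩q∣≤∣q∣ p (F zero)) (F≤D zero))
                                      (union-bound k (F ∘ suc) cover′ (F≤D ∘ suc)) ⟩
  _                               ∎
  where
  open ≤-Reasoning
  cover′ : ∀ {x} → x ∈ p ─ F zero → ∃ λ i → x ∈ F (suc i)
  cover′ x∈ with cover (p─q⊆p p (F zero) x∈)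
  ... | zero  , x∈F₀ = contradiction x∈F₀ (x∈p─q⇒x∉q {p = p} x∈)
  ... | suc i , x∈Fᵢ = i , x∈Fᵢ

truncate : ∀ k (p : Subset n) → k ≤ ∣ p ∣ → ∃ λ q → q ⊆ p × ∣ q ∣ ≡ k
truncate {n = n} zero p _ = ⊥ , ⊥⊆ , ∣⊥∣≡0 n
truncate (suc k) (true ∷ p) (s≤s k≤) with truncate k p k≤
... | q , q⊆p , eq = true ∷ q , in⊆in q⊆p , cong suc eq
truncate (suc k) (false ∷ p) k≤ with truncate (suc k) p k≤
... | q , q⊆p , eq = false ∷ q , out⊆ q⊆p , eq

-- The size is an index of its own rather than `∣ p ∣`, so that an enumeration can be moved along a
-- size equation such as the one from `truncate`.
record Enumeration (p : Subset n) (k : ℕ) : Set where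
  field
    at         : Fin k → Fin n
    injective  : Injective _≡_ _≡_ at
    sound      : ∀ i → at i ∈ p
    complete   : ∀ {x} → x ∈ p → ∃ λ i → at i ≡ x

enumerate : (p : Subset n) → Enumeration p ∣ p ∣
enumerate [] = record { at = λ () ; injective = λ { {()} } ; sound = λ () ; complete = λ () }
enumerate (true ∷ p) = record
  { at        = λ { zero → zero ; (suc i) → suc (at i) }
  ; injective = λ { {zero} {zero} _ → refl ; {suc _} {suc _} eq → cong suc (injective (suc-injective eq)) }
  ; sound     = λ { zero → here ; (suc i) → there (sound i) }
  ; complete  = λ { here → zero , refl
                  ; (there x∈p) → let i , eq = complete x∈p in suc i , cong suc eq } }
  where open Enumeration (enumerate p)
enumerate (false ∷ p) = record
  { at        = suc ∘ at
  ; injective = injective ∘ suc-injective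
  ; sound     = there ∘ sound
  ; complete  = λ { (there x∈p) → let i , eq = complete x∈p in i , cong suc eq } }
  where open Enumeration (enumerate p)

-- Take the larger of the two parts of `p` on which `P` holds or fails. The last component, read for
-- all pairs, says that `P` is constant on `q`.
halve : ∀ {P : Fin n → Set} → Decidable P → (p : Subset n) →
        ∃ λ q → q ⊆ p × ∣ p ∣ ≤ 2 * ∣ q ∣ × (∀ {x y} → x ∈ q → y ∈ q → P x → P y)
halve P? p with ∣ p ─ select P? ∣ ≤? ∣ p ∩ select P? ∣
... | yes ≤∩ = p ∩ select P? , p∩q⊆p p _ ,
  ≤-trans (∣p∣≤∣p∩q∣+∣p─q∣ p (select P?))
          (+-monoʳ-≤ ∣ p ∩ select P? ∣ (≤-trans ≤∩ (m≤m+n _ 0))) ,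
  λ _ y∈ _ → ∈-select⁻ P? (proj₂ (x∈p∩q⁻ p _ y∈))
... | no ≰∩ = p ─ select P? , p─q⊆p p _ ,
  ≤-trans (∣p∣≤∣p∩q∣+∣p─q∣ p (select P?))
          (+-mono-≤ (<⇒≤ (≰⇒> ≰∩)) (m≤m+n _ 0)) ,
  λ x∈ _ px → contradiction (∈-select⁺ P? px) (x∈p─q⇒x∉q {p = p} x∈)

-- One halving per predicate; predicates already constant stay constant on subsets.
homogenise : ∀ k {P : Fin k → Fin n → Set} → (∀ i → Decidable (P i)) → (p : Subset n) →
             ∃ λ q → q ⊆ p × ∣ p ∣ ≤ 2 ^ k * ∣ q ∣ ×
                     (∀ i {x y} → x ∈ q → y ∈ q → P i x → P i y)
homogenise zero P? p = p , id , m≤m+n _ 0 , λ ()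
homogenise (suc k) P? p with halve (P? zero) p
... | q , q⊆p , ≤q , same with homogenise k (P? ∘ suc) q
... | r , r⊆q , ≤r , sameᵣ = r , q⊆p ∘ r⊆q ,
  (begin
    ∣ p ∣               ≤⟨ ≤q ⟩
    2 * ∣ q ∣           ≤⟨ *-monoʳ-≤ 2 ≤r ⟩
    2 * (2 ^ k * ∣ r ∣) ≡⟨ *-assoc 2 (2 ^ k) ∣ r ∣ ⟨
    2 ^ suc k * ∣ r ∣   ∎) ,
  λ { zero x∈ y∈ → same (r⊆q x∈) (r⊆q y∈) ; (suc i) → sameᵣ i }
  where open ≤-Reasoning

-- Independent sets and bicliques

-- In a transversal of k + 1 sets, t s + t is the size needed in few-dominators
-- with s = threshold t k; each of the k later sets then excludes at most t
-- candidates from the first set, so k t + 1 candidates leave one to pick.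
threshold : ℕ → ℕ → ℕ
threshold t zero    = t
threshold t (suc k) = suc (k * t) + (t * threshold t k + t)

t≤threshold : ∀ t k → t ≤ threshold t k
t≤threshold t zero    = ≤-refl
t≤threshold t (suc k) = ≤-trans (m≤n+m t (t * threshold t k)) (m≤n+m _ (suc (k * t)))

-- The value D of the overview, for `μ * t + 1` high vertices: the power of two pays for
-- `homogenise`, the other factor is what `independent-transversal` requires.
lowDegree : ℕ → ℕ → ℕ
lowDegree μ t = 2 ^ suc (μ * t) * threshold t (suc (μ * t))

module _ (G : Graph) where
  open Graph G using (adj?; adj-sym; adj-irrefl)

  N : V G → Subset (order G)
  N v = select (adj? v)

  independent? : ∀ S → Dec (Independent G S)
  independent? S = all? λ u → all? λ v → (u ∈? S) →-dec (v ∈? S) →-dec ¬? (adj? u v)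

  independent-⊆ : ∀ {S S′} → S ⊆ S′ → Independent G S′ → Independent G S
  independent-⊆ S⊆ ind u v u∈ v∈ = ind u v (S⊆ u∈) (S⊆ v∈)

  -- A vertex of `X` outside `S` without a neighbour in `S` could be added to `S`, giving a larger
  -- independent set.
  maximal-dominates : ∀ {X S} → Independent G S →
    (∀ {S′} → Independent G S′ → S′ ⊆ X → ∣ S′ ∣ ≤ ∣ S ∣) → S ⊆ X →
    ∀ {v} → v ∈ X → v ∉ S → ∃ λ a → a ∈ S × Adj G a v
  maximal-dominates {X} {S} ind max S⊆X {v} v∈X v∉S with any? (λ a → (a ∈? S) ×-dec adj? a v)
  ... | yes found = found
  ... | no none = contradiction (max ind′ S+v⊆X) (<⇒≱ (p⊂q⇒∣p∣<∣q∣ S⊂S+v))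
    where
    S+v = S ∪ ⁅ v ⁆
    S⊂S+v : S ⊂ S+v
    S⊂S+v = p⊆p∪q ⁅ v ⁆ , v , q⊆p∪q S ⁅ v ⁆ (x∈⁅x⁆ v) , v∉S
    split : ∀ {x} → x ∈ S+v → x ∈ S ⊎ x ≡ v
    split x∈ = [ inj₁ , inj₂ ∘ x∈⁅y⁆⇒x≡y v ]′ (x∈p∪q⁻ S ⁅ v ⁆ x∈)
    S+v⊆X : S+v ⊆ X
    S+v⊆X x∈ with split x∈
    ... | inj₁ x∈S = S⊆X x∈S
    ... | inj₂ refl = v∈X
    ind′ : Independent G S+v
    ind′ x y x∈ y∈ xy with split x∈ | split y∈
    ... | inj₁ x∈S | inj₁ y∈S = ind x y x∈S y∈S xy
    ... | inj₁ x∈S | inj₂ refl = none (x , x∈S , xy)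
    ... | inj₂ refl | inj₁ y∈S = none (y , y∈S , adj-sym xy)
    ... | inj₂ refl | inj₂ refl = adj-irrefl refl xy

  module _ {t} .{{_ : NonZero t}} (free : Biclique-free t G) where

    -- Trimming both sets to `t` vertices would give a biclique. Independence of the sides makes the
    -- copy induced, and irreflexivity of adjacency makes the sides disjoint.
    complete-pair-bound : ∀ {P Q} → Independent G P → Independent G Q →
      (∀ {x y} → x ∈ P → y ∈ Q → Adj G x y) → t ≤ ∣ P ∣ → ∣ Q ∣ < t
    complete-pair-bound {P} {Q} indP indQ PQ t≤P = ≰⇒> λ t≤Q →
      let P′ , P′⊆P , P′≡t = truncate t P t≤P
          Q′ , Q′⊆Q , Q′≡t = truncate t Q t≤Q
      in free (copy (subst (Enumeration P′) P′≡t (enumerate P′)) P′⊆P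
                    (subst (Enumeration Q′) Q′≡t (enumerate Q′)) Q′⊆Q)
      where
      module _ {P′ Q′} (eP : Enumeration P′ t) (P′⊆P : P′ ⊆ P)
                       (eQ : Enumeration Q′ t) (Q′⊆Q : Q′ ⊆ Q) where
        module P = Enumeration eP
        module Q = Enumeration eQ

        P∈ : ∀ i → P.at i ∈ P
        P∈ = P′⊆P ∘ P.sound
        Q∈ : ∀ i → Q.at i ∈ Q
        Q∈ = Q′⊆Q ∘ Q.sound

        place : Fin t ⊎ Fin t → V G
        place = [ P.at , Q.at ]′

        place-injective : ∀ a b → place a ≡ place b → a ≡ b
        place-injective (inj₁ _) (inj₁ _) eq = cong inj₁ (P.injective eq)
        place-injective (inj₂ _) (inj₂ _) eq = cong inj₂ (Q.injective eq)
        place-injective (inj₁ i) (inj₂ j) eq = contradiction (PQ (P∈ i) (Q∈ j)) (adj-irrefl eq)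
        place-injective (inj₂ i) (inj₁ j) eq = contradiction (PQ (P∈ j) (Q∈ i)) (adj-irrefl (sym eq))

        copy : InducedCopy (Biclique t) G
        copy = record
          { embed     = place ∘ splitAt t
          ; injective = λ {u} {v} eq → trans (sym (join-splitAt t t u))
              (trans (cong (join t t) (place-injective (splitAt t u) (splitAt t v) eq)) (join-splitAt t t v))
          ; adjacency = adjacency }
          where
          adjacency : ∀ u v → side t u ≢ side t v ⇔ Adj G (place (splitAt t u)) (place (splitAt t v))
          adjacency u v with splitAt t u | splitAt t v
          ... | inj₁ i | inj₁ j = mk⇔ (contradiction refl) λ ij _ → indP _ _ (P∈ i) (P∈ j) ij
          ... | inj₂ i | inj₂ j = mk⇔ (contradiction refl) λ ij _ → indQ _ _ (Q∈ i) (Q∈ j) ij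
          ... | inj₁ i | inj₂ j = mk⇔ (λ _ → PQ (P∈ i) (Q∈ j)) λ _ ()
          ... | inj₂ i | inj₁ j = mk⇔ (λ _ → adj-sym (PQ (P∈ j) (Q∈ i))) λ _ ()

    -- t such w would have at least t common neighbours in Q.
    few-dominators : ∀ {P Q s} → Independent G P → Independent G Q → t * s + t ≤ ∣ Q ∣ →
      (∀ {w} → w ∈ P → ∣ Q ─ N w ∣ < s) → ∣ P ∣ ≤ t
    few-dominators {P} {Q} {s} indP indQ large dom = ≮⇒≥ λ t<P → use (truncate t P (<⇒≤ t<P))
      where
      use : ¬ ∃ λ T → T ⊆ P × ∣ T ∣ ≡ t
      use (T , T⊆P , T≡t) = <⇒≱ common<t (+-cancelˡ-≤ (t * s) _ _ (begin
        t * s + t                       ≤⟨ large ⟩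
        ∣ Q ∣                           ≤⟨ ∣p∣≤∣p∩q∣+∣p─q∣ Q C ⟩
        ∣ Q ∩ C ∣ + ∣ Q ─ C ∣           ≤⟨ +-monoʳ-≤ ∣ Q ∩ C ∣ (union-bound t (λ i → Q ─ N (at i)) cover
                                            λ i → <⇒≤ (dom (T⊆P (sound i)))) ⟩
        ∣ Q ∩ C ∣ + t * s               ≡⟨ +-comm ∣ Q ∩ C ∣ (t * s) ⟩
        t * s + ∣ Q ∩ C ∣               ∎))
        where
        open ≤-Reasoning
        open Enumeration (subst (Enumeration T) T≡t (enumerate T))
        common? : Decidable λ x → ∀ i → Adj G (at i) x
        common? x = all? λ i → adj? (at i) x
        C = select common?
        common<t : ∣ Q ∩ C ∣ < t
        common<t = complete-pair-bound (independent-⊆ T⊆P indP) (independent-⊆ (p∩q⊆p Q C) indQ)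
          (λ x∈T y∈ → let i , eq = complete x∈T in
            subst (λ x → Adj G x _) eq (∈-select⁻ common? (proj₂ (x∈p∩q⁻ Q C y∈)) i))
          (≤-reflexive (sym T≡t))
        cover : ∀ {x} → x ∈ Q ─ C → ∃ λ i → x ∈ Q ─ N (at i)
        cover {x} x∈ with ¬∀⟶∃¬ _ _ (λ i → adj? (at i) x)
                            (x∈p─q⇒x∉q {p = Q} x∈ ∘ ∈-select⁺ common?)
        ... | i , ¬adj = i , x∈p∧x∉q⇒x∈p─q (p─q⊆p Q C x∈) (¬adj ∘ ∈-select⁻ (adj? (at i)))

    -- Greedy choice: deleting the neighbours of the first pick from the later sets keeps all later
    -- picks nonadjacent to it, so the first pick has to leave every later set large.
    independent-transversal : ∀ k (F : Fin k → Subset (order G)) →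
      (∀ i → Independent G (F i)) → (∀ i → threshold t k ≤ ∣ F i ∣) →
      ∃ λ (w : Fin k → V G) → (∀ i → w i ∈ F i) × (∀ i j → ¬ Adj G (w i) (w j))
    independent-transversal zero F _ _ = (λ ()) , (λ ()) , λ ()
    independent-transversal (suc k) F ind large =
      let w₀ , w₀∈F₀ , rest-large = pick
          w , w∈ , w-ind = independent-transversal k (λ i → F (suc i) ─ N w₀)
            (λ i → independent-⊆ (p─q⊆p _ (N w₀)) (ind (suc i))) rest-large
          w₀w = λ i → x∈p─q⇒x∉q {p = F (suc i)} (w∈ i) ∘ ∈-select⁺ (adj? w₀)
      in (λ { zero → w₀ ; (suc i) → w i })
       , (λ { zero → w₀∈F₀ ; (suc i) → p─q⊆p (F (suc i)) (N w₀) (w∈ i) })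
       , λ { zero zero → adj-irrefl refl ; zero (suc j) → w₀w j
           ; (suc i) zero → w₀w i ∘ adj-sym ; (suc i) (suc j) → w-ind i j }
      where
      good? : ∀ w → Decidable λ i → threshold t k ≤ ∣ F (suc i) ─ N w ∣
      good? w i = _ ≤? _
      pick : ∃ λ w₀ → w₀ ∈ F zero × ∀ i → threshold t k ≤ ∣ F (suc i) ─ N w₀ ∣
      pick with any? (λ w → (w ∈? F zero) ×-dec all? (good? w))
      ... | yes found = found
      -- Otherwise every element of `F zero` cuts some later set below `threshold t k`. By
      -- `few-dominators` at most `t` elements do so for each of the `k` sets, yet `F zero` has more
      -- than `k * t`.
      ... | no none = contradiction
        (union-bound k (λ i → F zero ∩ select (bad? i)) cover λ i → few-dominators
          (independent-⊆ (p∩q⊆p (F zero) _) (ind zero)) (ind (suc i))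
          (≤-trans (m≤n+m _ (suc (k * t))) (large (suc i)))
          λ w∈ → ∈-select⁻ (bad? i) (proj₂ (x∈p∩q⁻ (F zero) _ w∈)))
        (<⇒≱ (≤-trans (m≤m+n (suc (k * t)) _) (large zero)))
        where
        bad? : ∀ i → Decidable λ w → ∣ F (suc i) ─ N w ∣ < threshold t k
        bad? i w = _ <? _
        cover : ∀ {w} → w ∈ F zero → ∃ λ i → w ∈ F zero ∩ select (bad? i)
        cover {w} w∈ with ¬∀⟶∃¬ k _ (good? w) (λ all → none (w , w∈ , all))
        ... | i , ¬good = i , x∈p∩q⁺ (w∈ , ∈-select⁺ (bad? i) (≰⇒> ¬good))

-- Induced matchings touching a bag

  module _ {X μ} (touching≤μ : ∀ {k} (M : InducedMatching G k) → Touches G M X → k ≤ μ) where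

    module _ {A J} (indA : Independent G A) (indJ : Independent G J) (touch : A ⊆ X ⊎ J ⊆ X) where

      -- The edges from `at i` to `p i` form an induced matching. Each has one end in `A` and one in
      -- `J`, so either inclusion in `X` makes it touch `X`.
      private-neighbours-bound : ∀ {k} (eA : Enumeration A k) → let open Enumeration eA in
        (p : Fin k → V G) → (∀ i → p i ∈ J) → (∀ i → Adj G (at i) (p i)) →
        (∀ {i j} → i ≢ j → ¬ Adj G (at i) (p j)) → k ≤ μ
      private-neighbours-bound {k} eA p p∈J adj priv = touching≤μ M (touches touch)
        where
        open Enumeration eA
        -- Equality would put the edge from `at j` to `p j` inside `A`.
        A≢J : ∀ {i j} → at i ≢ p j
        A≢J {i} {j} eq = indA _ _ (sound j) (sound i) (subst (Adj G (at j)) (sym eq) (adj j))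
        M : InducedMatching G k
        M = record
          { edge     = λ i → record { src = at i ; tgt = p i ; adjacent = adj i }
          ; disjoint = λ
            { i≢j (inj₁ refl) (inj₁ refl) eq → i≢j (injective eq)
            ; i≢j (inj₁ refl) (inj₂ refl) → A≢J
            ; i≢j (inj₂ refl) (inj₁ refl) → A≢J ∘ sym
            ; {i} i≢j (inj₂ refl) (inj₂ refl) eq →
                priv i≢j (subst (Adj G (at i)) eq (adj i)) }
          ; induced  = λ
            { i≢j (inj₁ refl) (inj₁ refl) → indA _ _ (sound _) (sound _)
            ; i≢j (inj₁ refl) (inj₂ refl) → priv i≢j
            ; i≢j (inj₂ refl) (inj₁ refl) → priv (≢-sym i≢j) ∘ adj-sym
            ; i≢j (inj₂ refl) (inj₂ refl) → indJ _ _ (p∈J _) (p∈J _) } }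
        touches : A ⊆ X ⊎ J ⊆ X → Touches G M X
        touches (inj₁ A⊆X) i = at i , inj₁ refl , A⊆X (sound i)
        touches (inj₂ J⊆X) i = p i , inj₂ refl , J⊆X (p∈J i)

    domination-bound : ∀ {D J} A → Independent G A → Independent G J → A ⊆ X ⊎ J ⊆ X →
      (∀ {j} → j ∈ J → ∃ λ a → a ∈ A × Adj G a j) →
      (∀ {a} → a ∈ A → ∣ J ∩ N a ∣ ≤ D) → ∣ J ∣ ≤ μ * D
    domination-bound {D} {J} A₀ = go (suc ∣ A₀ ∣) A₀ ≤-refl
      where
      -- The counter `c` drops with every discarded element and makes the recursion structural.
      go : ∀ c A → ∣ A ∣ < c → Independent G A → Independent G J → A ⊆ X ⊎ J ⊆ X →
        (∀ {j} → j ∈ J → ∃ λ a → a ∈ A × Adj G a j) →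
        (∀ {a} → a ∈ A → ∣ J ∩ N a ∣ ≤ D) → ∣ J ∣ ≤ μ * D
      go (suc c) A (s≤s A≤c) indA indJ touch dom deg = case-redundant (any? λ a → (a ∈? A) ×-dec redundant? a)
        where
        Dominated : V G → V G → Set
        Dominated a j = ∃ λ a′ → a′ ∈ A - a × Adj G a′ j
        Redundant : V G → Set
        Redundant a = ∀ j → j ∈ J → Dominated a j
        dominated? : ∀ a → Decidable (Dominated a)
        dominated? a j = any? λ a′ → (a′ ∈? (A - a)) ×-dec adj? a′ j
        redundant? : Decidable Redundant
        redundant? a = all? λ j → (j ∈? J) →-dec dominated? a j

        private-neighbour : ∀ {a} → a ∈ A → ¬ Redundant a →
          ∃ λ j → j ∈ J × Adj G a j × ¬ Dominated a j
        private-neighbour {a} a∈A ¬red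
          with ¬∀⟶∃¬ _ _ (λ j → (j ∈? J) →-dec dominated? a j) ¬red
        ... | j , ¬dom with j ∈? J
        ...   | no j∉J = contradiction (λ j∈J → contradiction j∈J j∉J) ¬dom
        ...   | yes j∈J with dom j∈J
        -- No element of `A - a` dominates `j`, so its dominator in `A` has to be `a` itself.
        ...     | a′ , a′∈A , a′j with a′ ≟ a
        ...       | yes refl = j , j∈J , a′j , λ d → ¬dom λ _ → d
        ...       | no a′≢a =
          contradiction (λ _ → a′ , x∈p∧x≢y⇒x∈p-y a′∈A a′≢a , a′j) ¬dom

        case-redundant : Dec (∃ λ a → a ∈ A × Redundant a) → ∣ J ∣ ≤ μ * D
        case-redundant (yes (a , a∈A , red)) = go c (A - a)
          (≤-trans (x∈p⇒∣p-x∣<∣p∣ a∈A) A≤c) (independent-⊆ A-a⊆A indA) indJ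
          (touch-A-a touch) (red _) (deg ∘ A-a⊆A)
          where
          A-a⊆A : A - a ⊆ A
          A-a⊆A = p─q⊆p A ⁅ a ⁆
          touch-A-a : A ⊆ X ⊎ J ⊆ X → A - a ⊆ X ⊎ J ⊆ X
          touch-A-a (inj₁ A⊆X) = inj₁ (A⊆X ∘ A-a⊆A)
          touch-A-a (inj₂ J⊆X) = inj₂ J⊆X
        case-redundant (no none) = begin
          ∣ J ∣     ≤⟨ union-bound ∣ A ∣ (λ i → J ∩ N (at i)) cover (deg ∘ sound) ⟩
          ∣ A ∣ * D ≤⟨ *-monoˡ-≤ D (private-neighbours-bound indA indJ touch (enumerate A)
                        (proj₁ ∘ priv) (proj₁ ∘ proj₂ ∘ priv) (proj₁ ∘ proj₂ ∘ proj₂ ∘ priv)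
                        λ {i} {j} i≢j ij → proj₂ (proj₂ (proj₂ (priv j)))
                          (at i , x∈p∧x≢y⇒x∈p-y (sound i) (i≢j ∘ injective) , ij)) ⟩
          μ * D     ∎
          where
          open ≤-Reasoning
          open Enumeration (enumerate A)
          priv : ∀ i → ∃ λ j → j ∈ J × Adj G (at i) j × ¬ Dominated (at i) j
          priv i = private-neighbour (sound i) λ red → none (at i , sound i , red)
          cover : ∀ {j} → j ∈ J → ∃ λ i → j ∈ J ∩ N (at i)
          cover j∈J with dom j∈J
          ... | a , a∈A , aj with complete a∈A
          ...   | i , refl = i , x∈p∩q⁺ (j∈J , ∈-select⁺ (adj? (at i)) aj)

  -- High and low vertices

  High : ℕ → V G → Set
  High D v = ∃ λ S → Independent G S × S ⊆ N v × D < ∣ S ∣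

  high? : ∀ D → Decidable (High D)
  high? D v = anySubset? λ S → independent? S ×-dec (S ⊆? N v) ×-dec (D <? ∣ S ∣)

  low-bound : ∀ {D v S} → ¬ High D v → Independent G S → ∣ S ∩ N v ∣ ≤ D
  low-bound {v = v} {S} ¬high ind = ≮⇒≥ λ D< →
    ¬high (S ∩ N v , independent-⊆ (p∩q⊆p S (N v)) ind , p∩q⊆q S (N v) , D<)

  module _ {t} .{{_ : NonZero t}} (free : Biclique-free t G)
           {X μ} (touching≤μ : ∀ {k} (M : InducedMatching G k) → Touches G M X → k ≤ μ) where

    -- Picks from the neighbourhoods of `B` form an independent set dominating `B`, and each sees at
    -- most `t` vertices of `B`; `domination-bound` then applies with `B` as the dominated set.
    high-bound-enumerated : ∀ {k B} → Enumeration B k → Independent G B → B ⊆ X →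
      (∀ {v} → v ∈ B → High (2 ^ k * threshold t k) v) → ∣ B ∣ ≤ μ * t
    high-bound-enumerated {k} {B} eB indB B⊆X high =
      domination-bound touching≤μ W indW indB (inj₂ B⊆X) dom deg
      where
      open Enumeration eB
      -- All vertices of F i have the same neighbours in B, so more than t of
      -- them would form a biclique with F i.
      refined : ∀ i → _
      refined i = homogenise k (λ j x → adj? (at j) x) (proj₁ (high (sound i)))
      S F : Fin k → Subset (order G)
      S i = proj₁ (high (sound i))
      F i = proj₁ (refined i)
      F⊆S : ∀ i → F i ⊆ S i
      F⊆S i = proj₁ (proj₂ (refined i))
      F⊆N : ∀ i {x} → x ∈ F i → Adj G (at i) x
      F⊆N i x∈ = ∈-select⁻ (adj? (at i)) (proj₁ (proj₂ (proj₂ (high (sound i)))) (F⊆S i x∈))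
      indF : ∀ i → Independent G (F i)
      indF i = independent-⊆ (F⊆S i) (proj₁ (proj₂ (high (sound i))))
      -- The factor `2 ^ k` in the degree cancels the loss from homogenising.
      largeF : ∀ i → threshold t k ≤ ∣ F i ∣
      largeF i = <⇒≤ (*-cancelˡ-< (2 ^ k) _ _
        (<-≤-trans (proj₂ (proj₂ (proj₂ (high (sound i))))) (proj₁ (proj₂ (proj₂ (refined i))))))
      same : ∀ i j {x y} → x ∈ F i → y ∈ F i → Adj G (at j) x → Adj G (at j) y
      same i = proj₂ (proj₂ (proj₂ (refined i)))

      transversal = independent-transversal free k F indF largeF
      w = proj₁ transversal
      w∈F = proj₁ (proj₂ transversal)
      -- Picks for different indices may coincide, so `W` is the image of `w`.
      picked? : Decidable λ x → ∃ λ i → w i ≡ x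
      picked? x = any? λ i → w i ≟ x
      W = select picked?
      indW : Independent G W
      indW u v u∈ v∈ with ∈-select⁻ picked? u∈ | ∈-select⁻ picked? v∈
      ... | i , refl | j , refl = proj₂ (proj₂ transversal) i j
      dom : ∀ {b} → b ∈ B → ∃ λ a → a ∈ W × Adj G a b
      dom b∈B with complete b∈B
      ... | i , refl = w i , ∈-select⁺ picked? (i , refl) , adj-sym (F⊆N i (w∈F i))
      deg : ∀ {a} → a ∈ W → ∣ B ∩ N a ∣ ≤ t
      deg a∈W with ∈-select⁻ picked? a∈W
      ... | i , refl = ≮⇒≥ λ t< → <⇒≱
        (complete-pair-bound free (independent-⊆ (p∩q⊆p B (N (w i))) indB) (indF i) complete′ (<⇒≤ t<))
        (≤-trans (t≤threshold t k) (largeF i))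
        where
        complete′ : ∀ {x y} → x ∈ B ∩ N (w i) → y ∈ F i → Adj G x y
        complete′ x∈ y∈ with x∈p∩q⁻ B (N (w i)) x∈
        ... | x∈B , x∈N with complete x∈B
        ...   | j , refl = same i j (w∈F i) y∈ (adj-sym (∈-select⁻ (adj? (w i)) x∈N))

    -- The degree required by `high-bound-enumerated` grows with the size of `B`. Hence a set that
    -- is too large is first cut down to `μ * t + 1` vertices, where the bound is already violated.
    high-bound : ∀ {B} → Independent G B → B ⊆ X →
      (∀ {v} → v ∈ B → High (lowDegree μ t) v) → ∣ B ∣ ≤ μ * t
    high-bound {B} indB B⊆X high = ≮⇒≥ λ μt< → use (truncate _ B μt<)
      where
      use : ¬ ∃ λ B′ → B′ ⊆ B × ∣ B′ ∣ ≡ suc (μ * t)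
      use (B′ , B′⊆B , eq) = <⇒≱ (≤-reflexive (sym eq))
        (high-bound-enumerated (subst (Enumeration B′) eq (enumerate B′))
          (independent-⊆ B′⊆B indB) (B⊆X ∘ B′⊆B) (high ∘ B′⊆B))

-- Attaching leaves to a tree

-- Predecessor and successor in cyclic order, which differ because the length is at least three.
two-neighbours : ∀ {T} (C : Cycle T) → let open Cycle C in
  ∀ i → ∃₂ λ p q → p ≢ q × Adj T (vertex i) (vertex p) × Adj T (vertex i) (vertex q)
two-neighbours {T} C zero = suc zero , fromℕ _ , (λ ()) , Cycle.step C zero , Graph.adj-sym T (Cycle.close C)
two-neighbours {T} C (suc j) with view j
... | ‵fromℕ = inject₁ (fromℕ _) , zero , (λ ()) ,
  Graph.adj-sym T (Cycle.step C (fromℕ _)) , Cycle.close C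
... | ‵inject₁ m = inject₁ (inject₁ m) , suc (suc m) ,
  (λ eq → m≢1+n+m (toℕ m) {1} (trans (sym (trans (toℕ-inject₁ (inject₁ m)) (toℕ-inject₁ m))) (cong toℕ eq))) ,
  Graph.adj-sym T (Cycle.step C (inject₁ m)) , Cycle.step C (suc m)

module _ (T : Graph) {n} (host : Fin n → V T) where

  -- The sum type keeps tree nodes and leaves apart by pattern matching; `attachLeaves` moves `Link`
  -- to `Fin` along `splitAt`.
  Node : Set
  Node = V T ⊎ Fin n

  Link : Node → Node → Set
  Link (inj₁ x) (inj₁ y) = Adj T x y
  Link (inj₁ x) (inj₂ v) = host v ≡ x
  Link (inj₂ v) (inj₁ x) = host v ≡ x
  Link (inj₂ _) (inj₂ _) = Empty

  link? : ∀ a b → Dec (Link a b)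
  link? (inj₁ x) (inj₁ y) = Graph.adj? T x y
  link? (inj₁ x) (inj₂ v) = host v ≟ x
  link? (inj₂ v) (inj₁ x) = host v ≟ x
  link? (inj₂ _) (inj₂ _) = no λ ()

  link-sym : ∀ a b → Link a b → Link b a
  link-sym (inj₁ x) (inj₁ y) = Graph.adj-sym T
  link-sym (inj₁ x) (inj₂ v) = id
  link-sym (inj₂ v) (inj₁ x) = id
  link-sym (inj₂ _) (inj₂ _) = id

  link-irrefl : ∀ a → ¬ Link a a
  link-irrefl (inj₁ x) = Graph.adj-irrefl T refl
  link-irrefl (inj₂ _) ()

  attachLeaves : Graph
  attachLeaves = record
    { order      = order T + n
    ; nonempty   = ≢-nonZero λ eq → ≢-nonZero⁻¹ (order T) {{Graph.nonempty T}} (m+n≡0⇒m≡0 (order T) eq)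
    ; Adj        = λ u v → Link (splitAt (order T) u) (splitAt (order T) v)
    ; adj?       = λ u v → link? (splitAt (order T) u) (splitAt (order T) v)
    ; adj-sym    = λ {u} {v} → link-sym (splitAt (order T) u) (splitAt (order T) v)
    ; adj-irrefl = λ { {u} refl → link-irrefl (splitAt (order T) u) }
    }

  splitAt-injective : ∀ {u v} → splitAt (order T) {n} u ≡ splitAt (order T) v → u ≡ v
  splitAt-injective {u} {v} eq = trans (sym (join-splitAt (order T) n u))
    (trans (cong (join (order T) n) eq) (join-splitAt (order T) n v))

  module _ {P : Node → Set} (host-P : ∀ v → P (inj₂ v) → P (inj₁ (host v)))
           (connected : InducesConnected T (P ∘ inj₁)) where

    Step : Node → Node → Set
    Step a b = P a × P b × Link a b

    -- At an end that is a leaf the path passes through its host, where `P` holds by `host-P`; this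
    -- reduces everything to two nodes of `T`.
    join-nodes : ∀ {a b} → P a → P b → Star Step a b
    join-nodes {inj₁ x} {inj₁ y} pa pb = Star.gmap inj₁ id (connected pa pb)
    join-nodes {inj₁ x} {inj₂ v} pa pb =
      join-nodes pa (host-P v pb) ◅◅ (host-P v pb , pb , refl) ◅ ε
    join-nodes {inj₂ v} {inj₁ y} pa pb =
      (pa , host-P v pa , refl) ◅ join-nodes (host-P v pa) pb
    join-nodes {inj₂ v} {inj₂ v′} pa pb =
      (pa , host-P v pa , refl) ◅ join-nodes (host-P v pa) (host-P v′ pb)
        ◅◅ (host-P v′ pb , pb , refl) ◅ ε

    attachLeaves-induced : InducesConnected attachLeaves (P ∘ splitAt (order T))
    attachLeaves-induced {u} {v} pu pv =
      subst₂ (Star _) (join-splitAt (order T) n u) (join-splitAt (order T) n v)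
        (Star.gmap (join (order T) n) (λ {a} {b} → lift-step {a} {b}) (join-nodes pu pv))
      where
      lift-step : ∀ {a b} → Step a b →
        let s = splitAt (order T) ∘ join (order T) n in P (s a) × P (s b) × Link (s a) (s b)
      lift-step {a} {b} p rewrite splitAt-join (order T) n a | splitAt-join (order T) n b = p

  -- A vertex on a cycle has two distinct neighbours there, while a leaf has only its host. So the
  -- cycle avoids all leaves and lies in `T`.
  attachLeaves-acyclic : ¬ Cycle T → ¬ Cycle attachLeaves
  attachLeaves-acyclic acyclic C = acyclic record
    { vertex   = proj₁ ∘ inner
    ; distinct = λ {i} {j} eq → distinct (splitAt-injective
        (trans (proj₂ (inner i)) (trans (cong inj₁ eq) (sym (proj₂ (inner j))))))
    ; step     = λ i → subst₂ Link (proj₂ (inner (inject₁ i))) (proj₂ (inner (suc i))) (step i)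
    ; close    = subst₂ Link (proj₂ (inner (fromℕ _))) (proj₂ (inner zero)) close }
    where
    open Cycle C
    only-host : ∀ {a} v → Link (inj₂ v) a → a ≡ inj₁ (host v)
    only-host {inj₁ _} v refl = refl
    inner : ∀ i → ∃ λ x → splitAt (order T) (vertex i) ≡ inj₁ x
    inner i with splitAt (order T) (vertex i) | two-neighbours C i
    ... | inj₁ x | _ = x , refl
    ... | inj₂ v | p , q , p≢q , ip , iq = contradiction
      (distinct (splitAt-injective (trans (only-host v ip) (sym (only-host v iq))))) p≢q

  attachLeaves-tree : IsTree T → IsTree attachLeaves
  attachLeaves-tree (conn , acyclic) =
    (λ u v → Star.map (proj₂ ∘ proj₂) (attachLeaves-induced {P = λ _ → Unit} (λ _ _ → tt)
      (λ {x} {y} _ _ → Star.map (λ xy → tt , tt , xy) (conn x y)) {u} {v} tt tt)) ,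
    attachLeaves-acyclic acyclic

-- Replacing an independent set in the bags by its neighbourhood

module _ (G : Graph) (𝒯 : TreeDecomposition G) {I} (indI : Independent G I) where
  open Graph G using (adj?; adj-sym)
  open TreeDecomposition 𝒯

  host : V G → V T
  host v = proj₁ (vertex-covered v)

  Kept : V T → V G → Set
  Kept x u = u ∈ β x × u ∉ I

  Added : V T → V G → Set
  Added x u = ∃ λ v → v ∈ I × v ∈ β x × Adj G v u

  -- The leaf attached for a vertex outside I carries the empty bag.
  Bag : V T ⊎ V G → V G → Set
  Bag (inj₁ x) u = Kept x u ⊎ Added x u
  Bag (inj₂ v) u = v ∈ I × (u ≡ v ⊎ Adj G v u)

  bag? : ∀ z → Decidable (Bag z)
  bag? (inj₁ x) u = ((u ∈? β x) ×-dec ¬? (u ∈? I)) ⊎-dec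
                    any? λ v → (v ∈? I) ×-dec (v ∈? β x) ×-dec adj? v u
  bag? (inj₂ v) u = (v ∈? I) ×-dec ((u ≟ v) ⊎-dec adj? v u)

  T′ : Graph
  T′ = attachLeaves T host

  node : V T′ → V T ⊎ V G
  node = splitAt (order T)

  β′ : V T′ → Subset (order G)
  β′ z = select (bag? (node z))

  ∈β′ : ∀ a {u} → Bag a u → u ∈ β′ (join (order T) (order G) a)
  ∈β′ a {u} bag = ∈-select⁺ (bag? _)
    (subst (λ b → Bag b u) (sym (splitAt-join (order T) (order G) a)) bag)

  added∉I : ∀ {x u} → Added x u → u ∉ I
  added∉I (v , v∈I , _ , vu) u∈I = indI _ _ v∈I u∈I vu

  module _ {u} (u∉I : u ∉ I) where

    Path : V T → V T → Set
    Path = Star λ x y → Bag (inj₁ x) u × Bag (inj₁ y) u × Adj T x y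

    kept-path : ∀ {x y} → u ∈ β x → u ∈ β y → Path x y
    kept-path ux uy = Star.map
      (λ { (ux , uy , xy) → inj₁ (ux , u∉I) , inj₁ (uy , u∉I) , xy }) (connected u ux uy)

    added-path : ∀ {v x y} → v ∈ I → Adj G v u → v ∈ β x → v ∈ β y → Path x y
    added-path {v} v∈I vu vx vy = Star.map
      (λ { (vx , vy , xy) → inj₂ (v , v∈I , vx , vu) , inj₂ (v , v∈I , vy , vu) , xy })
      (connected v vx vy)

    -- If `u` was added because of `v`, some old bag `y` contains both: walk to `y` through bags
    -- containing `v`, then on through bags containing `u`.
    path-to-host : ∀ {x} → Bag (inj₁ x) u → Path x (host u)
    path-to-host (inj₁ (ux , _)) = kept-path ux (proj₂ (vertex-covered u))
    path-to-host (inj₂ (v , v∈I , vx , vu)) =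
      let y , vy , uy = edge-covered vu
      in added-path v∈I vu vx vy ◅◅ kept-path uy (proj₂ (vertex-covered u))

    old-nodes-connected : InducesConnected T (λ x → Bag (inj₁ x) u)
    old-nodes-connected bx by = path-to-host bx ◅◅
      Star.reverse (λ { (p , q , xy) → q , p , Graph.adj-sym T xy }) (path-to-host by)

    host-bag : ∀ v → Bag (inj₂ v) u → Bag (inj₁ (host v)) u
    host-bag v (v∈I , inj₁ refl) = contradiction v∈I u∉I
    host-bag v (v∈I , inj₂ vu)   = inj₂ (v , v∈I , proj₂ (vertex-covered v) , vu)

  -- Independence of `I` keeps `u` from being added to an old bag and from lying in the leaf bag of
  -- another vertex of `I`.
  only-leaf : ∀ {u} → u ∈ I → ∀ a → Bag a u → a ≡ inj₂ u
  only-leaf u∈I (inj₁ x) (inj₁ (_ , u∉I))       = contradiction u∈I u∉I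
  only-leaf u∈I (inj₁ x) (inj₂ added)           = contradiction u∈I (added∉I added)
  only-leaf u∈I (inj₂ v) (_ , inj₁ refl)        = refl
  only-leaf u∈I (inj₂ v) (v∈I , inj₂ vu)        = contradiction vu (indI _ _ v∈I u∈I)

  bags-connected : ∀ u → InducesConnected T′ (λ z → Bag (node z) u)
  bags-connected u {y} {z} by bz with u ∈? I
  ... | yes u∈I = subst (Star _ y) (splitAt-injective T host
    (trans (only-leaf u∈I (node y) by) (sym (only-leaf u∈I (node z) bz)))) ε
  ... | no u∉I = attachLeaves-induced T host {P = λ a → Bag a u}
    (host-bag u∉I) (old-nodes-connected u∉I) {y} {z} by bz

  bag-of : ∀ u → ∃ λ a → Bag a u
  bag-of u with u ∈? I
  ... | yes u∈I = inj₂ u , u∈I , inj₁ refl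
  ... | no  u∉I = inj₁ (host u) , inj₁ (proj₂ (vertex-covered u) , u∉I)

  -- An end in `I` has a leaf bag holding its whole closed neighbourhood; with no end in `I` the old
  -- bag still serves.
  bag-of-edge : ∀ {u v} → Adj G u v → ∃ λ a → Bag a u × Bag a v
  bag-of-edge {u} {v} uv with u ∈? I | v ∈? I
  ... | yes u∈I | _       = inj₂ u , (u∈I , inj₁ refl) , (u∈I , inj₂ uv)
  ... | no _    | yes v∈I = inj₂ v , (v∈I , inj₂ (adj-sym uv)) , (v∈I , inj₁ refl)
  ... | no u∉I  | no v∉I  =
    let x , ux , vx = edge-covered uv
    in inj₁ x , inj₁ (ux , u∉I) , inj₁ (vx , v∉I)

  refinement : TreeDecomposition G
  refinement = record
    { T              = T′
    ; isTree         = attachLeaves-tree T host isTree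
    ; β              = β′
    ; vertex-covered = λ v → let a , bag = bag-of v in _ , ∈β′ a bag
    ; edge-covered   = λ uv → let a , bu , bv = bag-of-edge uv in _ , ∈β′ a bu , ∈β′ a bv
    ; connected      = λ v {y} {z} yv zv → Star.map
        (λ { {y} {z} (p , q , yz) → ∈-select⁺ (bag? (node y)) p , ∈-select⁺ (bag? (node z)) q , yz })
        (bags-connected v (∈-select⁻ (bag? (node y)) yv) (∈-select⁻ (bag? (node z)) zv)) }

  -- Independent sets in the new bags

  module _ {μ t} .{{_ : NonZero t}} (free : Biclique-free t G)
           (touching≤μ : ∀ x {k} (M : InducedMatching G k) → Touches G M (β x) → k ≤ μ) where

    private
      D = lowDegree μ t

    module _ (low-I : ∀ {v} → v ∈ I → ¬ High G D v)
             (I-dominates : ∀ {v} → ¬ High G D v → v ∉ I → ∃ λ a → a ∈ I × Adj G a v) where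

      -- The summands account for high vertices, kept low vertices and added vertices. In the second
      -- case the dominated set lies in the old bag, in the third the dominating set `I ∩ β x` does.
      old-bag-bound : ∀ x {S} → Independent G S → (∀ {u} → u ∈ S → Bag (inj₁ x) u) →
                      ∣ S ∣ ≤ μ * t + (μ * D + μ * D)
      old-bag-bound x {S} indS S⊆ =
        ≤-trans (cover-bound S₁ (S₂ ∪ S₃) cover)
          (+-mono-≤ S₁-bound (≤-trans (∣p∪q∣≤∣p∣+∣q∣ S₂ S₃) (+-mono-≤ S₂-bound S₃-bound)))
        where
        kept-high? : Decidable λ u → u ∈ β x × High G D u
        kept-high? u = (u ∈? β x) ×-dec high? G D u
        kept-low? : Decidable λ u → Kept x u × ¬ High G D u
        kept-low? u = ((u ∈? β x) ×-dec ¬? (u ∈? I)) ×-dec ¬? (high? G D u)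
        added? : Decidable (Added x)
        added? u = any? λ v → (v ∈? I) ×-dec (v ∈? β x) ×-dec adj? v u
        S₁ = S ∩ select kept-high?
        S₂ = S ∩ select kept-low?
        S₃ = S ∩ select added?
        indS∩ : ∀ q → Independent G (S ∩ q)
        indS∩ q = independent-⊆ G (p∩q⊆p S q) indS
        in₁ : ∀ {u} → u ∈ S₁ → u ∈ β x × High G D u
        in₁ = ∈-select⁻ kept-high? ∘ p∩q⊆q S _
        in₂ : ∀ {u} → u ∈ S₂ → Kept x u × ¬ High G D u
        in₂ = ∈-select⁻ kept-low? ∘ p∩q⊆q S _
        in₃ : ∀ {u} → u ∈ S₃ → Added x u
        in₃ = ∈-select⁻ added? ∘ p∩q⊆q S _
        cover : ∀ {u} → u ∈ S → u ∈ S₁ ⊎ u ∈ S₂ ∪ S₃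
        cover {u} u∈S with S⊆ u∈S | high? G D u
        ... | inj₂ added | _ =
          inj₂ (q⊆p∪q S₂ S₃ (x∈p∩q⁺ (u∈S , ∈-select⁺ added? added)))
        ... | inj₁ (ux , _) | yes high =
          inj₁ (x∈p∩q⁺ (u∈S , ∈-select⁺ kept-high? (ux , high)))
        ... | inj₁ kept | no low =
          inj₂ (p⊆p∪q S₃ (x∈p∩q⁺ (u∈S , ∈-select⁺ kept-low? (kept , low))))
        S₁-bound : ∣ S₁ ∣ ≤ μ * t
        S₁-bound = high-bound G free (touching≤μ x) (indS∩ _) (proj₁ ∘ in₁) (proj₂ ∘ in₁)
        S₂-bound : ∣ S₂ ∣ ≤ μ * D
        S₂-bound = domination-bound G (touching≤μ x) I indI (indS∩ _)
          (inj₂ (proj₁ ∘ proj₁ ∘ in₂))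
          (λ u∈ → let (_ , u∉I) , low = in₂ u∈ in I-dominates low u∉I)
          (λ a∈I → low-bound G (low-I a∈I) (indS∩ _))
        S₃-bound : ∣ S₃ ∣ ≤ μ * D
        S₃-bound = domination-bound G (touching≤μ x) (I ∩ β x)
          (independent-⊆ G (p∩q⊆p I (β x)) indI) (indS∩ _) (inj₁ (p∩q⊆q I (β x)))
          (λ u∈ → let v , v∈I , vx , vu = in₃ u∈ in v , x∈p∩q⁺ (v∈I , vx) , vu)
          (λ a∈ → low-bound G (low-I (p∩q⊆p I (β x) a∈)) (indS∩ _))

      -- One for `v` itself and `D` for its neighbours, as `v` is low.
      leaf-bag-bound : ∀ v {S} → Independent G S → (∀ {u} → u ∈ S → Bag (inj₂ v) u) → ∣ S ∣ ≤ suc D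
      leaf-bag-bound v {S} indS S⊆ with v ∈? I
      ... | no v∉I = ≤-trans (p⊆q⇒∣p∣≤∣q∣ {q = ⊥} λ u∈ → contradiction (proj₁ (S⊆ u∈)) v∉I)
                             (≤-trans (≤-reflexive (∣⊥∣≡0 (order G))) z≤n)
      ... | yes v∈I = ≤-trans (cover-bound ⁅ v ⁆ (S ∩ N G v) cover)
          (+-mono-≤ (≤-reflexive (∣⁅x⁆∣≡1 v)) (low-bound G (low-I v∈I) indS))
        where
        cover : ∀ {u} → u ∈ S → u ∈ ⁅ v ⁆ ⊎ u ∈ S ∩ N G v
        cover u∈ with proj₂ (S⊆ u∈)
        ... | inj₁ refl = inj₁ (x∈⁅x⁆ v)
        ... | inj₂ vu   = inj₂ (x∈p∩q⁺ (u∈ , ∈-select⁺ (adj? v) vu))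

      -- The sum of the two bounds stands in for their maximum.
      bag-bound : ∀ a {S} → Independent G S → (∀ {u} → u ∈ S → Bag a u) →
                  ∣ S ∣ ≤ μ * t + (μ * D + μ * D) + suc D
      bag-bound (inj₁ x) indS S⊆ = ≤-trans (old-bag-bound x indS S⊆) (m≤m+n _ (suc D))
      bag-bound (inj₂ v) indS S⊆ = ≤-trans (leaf-bag-bound v indS S⊆) (m≤n+m (suc D) _)

      refinement-α : ∀ {k} → IsDecomposition-α G refinement k → k ≤ μ * t + (μ * D + μ * D) + suc D
      refinement-α ((z , (S , indS , S⊆ , refl) , _) , _) =
        bag-bound (node z) indS (∈-select⁻ (bag? (node z)) ∘ S⊆)

-- Passing from the parameters to the bounds

touching-bound : ∀ G 𝒯 {m} → IsDecomposition-μ G 𝒯 m → ∀ x {k} (M : InducedMatching G k) →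
                 Touches G M (TreeDecomposition.β 𝒯 x) → k ≤ m
-- The touching number of a bag is available only under double negation, which the decidable goal
-- absorbs.
touching-bound G 𝒯 {m} (_ , max) x {k} M touches = decidable-stable (k ≤? m) λ k≰m →
  μ-exists G _ λ (_ , isμ) → k≰m (≤-trans (proj₂ isμ (M , touches)) (max (x , isμ)))

decomposition-α-exists : ∀ G 𝒯 → ¬ ¬ ∃ (IsDecomposition-α G 𝒯)
decomposition-α-exists G 𝒯 = ¬¬-maximum (order G)
  (λ { (_ , (S , _ , _ , refl) , _) → ∣p∣≤n S })
  λ none → α-exists G (β x₀) λ (k , p) → none (k , x₀ , p)
  where
  open TreeDecomposition 𝒯
  -- The maximum needs at least one bag, and `T` has a node.
  x₀ : V T
  x₀ = fromℕ< {0} (>-nonZero⁻¹ (order T) {{Graph.nonempty T}})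

theorem1p1 : ∀ (μ t : ℕ) → .{{_ : NonZero μ}} → .{{_ : NonZero t}} →
    ∃ λ (K : ℕ) → ∀ (G : Graph) → Biclique-free t G →
    ∀ (m : ℕ) → IsTree-μ G m → m ≤ μ →
    ∀ (a : ℕ) → IsTree-α G a → a < K
theorem1p1 μ t = suc K , λ G free m ((𝒯 , 𝒯-μ) , _) m≤μ a (_ , a-min) →
  -- Decidability of the goal allows using `I` and the α of the refinement, both known to exist only
  -- up to double negation.
  decidable-stable (a <? suc K) λ a≮K →
  -- Taking `I` of maximum size among independent sets of low vertices makes it dominate all other
  -- low vertices.
  α-exists G (select (λ v → ¬? (high? G D v))) λ
  { (_ , (I , indI , I⊆ , refl) , max) →
  decomposition-α-exists G (refinement G 𝒯 indI) λ (k , isα) →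
  a≮K (s≤s (≤-trans (a-min (refinement G 𝒯 indI , isα))
    (refinement-α G 𝒯 indI free
      (λ x M touches → ≤-trans (touching-bound G 𝒯 𝒯-μ x M touches) m≤μ)
      (∈-select⁻ (λ v → ¬? (high? G D v)) ∘ I⊆)
      (λ low → maximal-dominates G indI (λ {S′} ind S′⊆ → max (S′ , ind , S′⊆ , refl)) I⊆
        (∈-select⁺ (λ v → ¬? (high? G D v)) low))
      isα))) }
  where
  D = lowDegree μ t
  K = μ * t + (μ * D + μ * D) + suc D
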